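{- A 3-Star Nim position $([a_1],[a_2],[a_3])$ is a $\mathcal{P}$-position if and only if $a_1\oplus a_2\oplus a_3=0$.
   Context: $m$-Star Nim: $m$ strips of squares numbered $0,1,2,\ldots$ share their square $0$; each strip carries one token, and the shared square $0$ holds at most one token. A position is a tuple $([a_1],\ldots,[a_m])$ of nonnegative integers with at most one $a_i$ equal to $0$. A move replaces exactly one $a_i$ by a smaller nonnegative integer, provided the result is a legal position (so $a_i$ may be replaced by $0$ only if no other token is on square $0$). The game is impartial and a player unable to move loses. A $\mathcal{P}$-position is one from which the player about to move has no winning strategy; equivalently, its Sprague-Grundy value is $0$. $\oplus$ is Nim-sum (bitwise addition mod 2 of binary representations). -}

module Defs where

open import Data.Digit using (Bit; fromDigits; toDigits)
open import Data.Fin.Base using (toℕ)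
open import Data.List.Base using (alignWith)
open import Data.Nat.Base using (ℕ; _+_; _<_)
open import Data.Nat.DivMod using (_mod_)
open import Data.Product.Base using (_×_; ∃-syntax; proj₁)
open import Data.These using (mergeThese)
open import Data.Vec.Base using (Vec; lookup; _[_]≔_)
open import Relation.Binary.PropositionalEquality.Core using (_≡_)
open import Relation.Nullary.Negation.Core using (¬_)

infixl 6 _⊕_
infixl 6 _+₂_
infix 4 _⟶_

_+₂_ : Bit → Bit → Bit
x +₂ y = (toℕ x + toℕ y) mod 2

-- toDigits lists the least significant bit first, so the expansions are aligned
-- at their heads; the surplus high bits of the longer one are kept unchanged.
_⊕_ : ℕ → ℕ → ℕ
a ⊕ b = fromDigits (alignWith (mergeThese _+₂_) (proj₁ (toDigits 2 a)) (proj₁ (toDigits 2 b)))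

-- At most one token is on the shared square 0.
Legal : ∀ {m} → Vec ℕ m → Set
Legal a = ∀ i j → lookup a i ≡ 0 → lookup a j ≡ 0 → i ≡ j

record Position (m : ℕ) : Set where
  constructor mkPosition
  field
    squares : Vec ℕ m
    legal   : Legal squares

open Position public

_⟶_ : ∀ {m} → Position m → Position m → Set
p ⟶ q = ∃[ i ] ∃[ b ] (b < lookup (squares p) i × squares q ≡ squares p [ i ]≔ b)

-- A winning strategy for the player about to move: a move, together with a
-- winning strategy after each reply of the opponent. The opponent being unable
-- to reply is the case where the second argument is vacuous.
data HasWinningStrategy {m : ℕ} (p : Position m) : Set where
  play : ∀ q → p ⟶ q → (∀ r → q ⟶ r → HasWinningStrategy r) → HasWinningStrategy p

IsPPosition : ∀ {m} → Position m → Set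
IsPPosition p = ¬ HasWinningStrategy p

{-# OPTIONS --safe #-}
-- This is Bouton's analysis of Nim. The shared square removes nothing from it when
-- there are three tokens: a position of Nim-sum 0 with two tokens on square 0 has
-- its third token there as well, so a Nim move to it would start from two tokens on
-- square 0. Hence a winning Nim move is always available in 3-Star Nim.
module Submission where

open import Defs
open import Algebra.Bundles using (AbelianGroup)
import Algebra.Properties.CommutativeSemigroup as CommutativeSemigroupProperties
import Algebra.Properties.Group as GroupProperties
open import Algebra.Structures using (IsAbelianGroup)
open import Data.Digit using (Bit; Expansion; fromDigits; toDigits)
open import Data.Fin.Base using (zero; suc; toℕ; punchIn)
open import Data.Fin.Properties using (punchInᵢ≢i; punchIn-injective)
  renaming (_≟_ to _≟ᶠ_)
open import Data.List.Base using ([]; _∷_; alignWith)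
open import Data.List.Properties using (map-id)
open import Data.Nat.Base
  using (ℕ; zero; suc; _+_; _*_; _≤_; _<_; z≤n; z<s; s<s; s≤s⁻¹; ⌊_/2⌋; parity)
open import Data.Nat.Induction using (<-rec)
open import Data.Nat.Properties
open import Data.Parity.Base as ℙ using (Parity; 0ℙ; 1ℙ)
import Data.Parity.Properties as ℙ
open import Data.Product.Base using (_×_; _,_; ∃-syntax; proj₁; proj₂)
open import Data.These using (mergeThese)
open import Data.Vec.Base using (Vec; []; _∷_; lookup; sum; _[_]≔_)
open import Data.Vec.Properties using (lookup∘update′)
open import Function.Base using (id; case_of_)
open import Function.Bundles using (_⇔_; mk⇔)
open import Level using (0ℓ)
open import Relation.Binary.PropositionalEquality
  using (_≡_; _≢_; refl; sym; trans; cong; cong₂; subst; isEquivalence; module ≡-Reasoning)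
open import Relation.Nullary.Decidable using (decidable-stable)
open import Relation.Nullary.Negation using (contradiction)

-- Binary digits by repeated halving.

bit : ℕ → ℕ → Parity
bit zero    n = parity n
bit (suc k) n = bit k ⌊ n /2⌋

bit-0 : ∀ k → bit k 0 ≡ 0ℙ
bit-0 zero    = refl
bit-0 (suc k) = bit-0 k

parity-half-injective : ∀ m n → parity m ≡ parity n → ⌊ m /2⌋ ≡ ⌊ n /2⌋ → m ≡ n
parity-half-injective 0             0             _ _ = refl
parity-half-injective 0             (suc (suc _)) _ ()
parity-half-injective 1             1             _ _ = refl
parity-half-injective (suc (suc m)) (suc (suc n)) p h =
  cong (λ x → suc (suc x)) (parity-half-injective m n p (suc-injective h))

-- Digit 0 is the parity and the later digits are those of the half, so the induction halves both
-- numbers; it runs on a common bound for them.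
bit-injective : ∀ {m n} → (∀ k → bit k m ≡ bit k n) → m ≡ n
bit-injective {m} {n} = bounded (m + n) m n (m≤m+n m n) (m≤n+m n m)
  where
  half≤ : ∀ {x N} → x ≤ suc N → ⌊ x /2⌋ ≤ N
  half≤ {N = N} x≤ = ≤-trans (⌊n/2⌋-mono x≤) (s≤s⁻¹ (⌊n/2⌋<n N))

  bounded : ∀ N x y → x ≤ N → y ≤ N → (∀ k → bit k x ≡ bit k y) → x ≡ y
  bounded zero    _ _ z≤n z≤n _ = refl
  bounded (suc N) x y x≤ y≤ eq  = parity-half-injective x y (eq 0)
    (bounded N ⌊ x /2⌋ ⌊ y /2⌋ (half≤ x≤) (half≤ y≤) (λ k → eq (suc k)))

-- Digits of a Nim-sum.

half-digit : ∀ (d : Bit) n → ⌊ toℕ d + n * 2 /2⌋ ≡ n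
half-digit zero       zero    = refl
half-digit zero       (suc n) = cong suc (half-digit zero n)
half-digit (suc zero) zero    = refl
half-digit (suc zero) (suc n) = cong suc (half-digit (suc zero) n)

parity-digit : ∀ (d : Bit) n → parity (toℕ d + n * 2) ≡ parity (toℕ d)
parity-digit zero       zero    = refl
parity-digit zero       (suc n) = parity-digit zero n
parity-digit (suc zero) zero    = refl
parity-digit (suc zero) (suc n) = parity-digit (suc zero) n

parity-+₂ : ∀ c d → parity (toℕ (c +₂ d)) ≡ parity (toℕ c) ℙ.+ parity (toℕ d)
parity-+₂ zero       zero       = refl
parity-+₂ zero       (suc zero) = refl
parity-+₂ (suc zero) zero       = refl
parity-+₂ (suc zero) (suc zero) = refl

-- There are no carries, so each position is computed on its own. Where one list has ended, its
-- missing digits count as 0.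
bit-align : ∀ k (xs ys : Expansion 2) →
  bit k (fromDigits (alignWith (mergeThese _+₂_) xs ys)) ≡
  bit k (fromDigits xs) ℙ.+ bit k (fromDigits ys)
-- `alignWith` maps the surplus digits through `mergeThese`, which acts on them as the identity.
bit-align k [] ys rewrite bit-0 k | map-id ys = refl
bit-align k (x ∷ xs) [] rewrite bit-0 k | map-id xs = sym (ℙ.+-identityʳ _)
bit-align zero (x ∷ xs) (y ∷ ys)
  rewrite parity-digit (x +₂ y) (fromDigits (alignWith (mergeThese _+₂_) xs ys))
        | parity-digit x (fromDigits xs)
        | parity-digit y (fromDigits ys) = parity-+₂ x y
bit-align (suc k) (x ∷ xs) (y ∷ ys)
  rewrite half-digit (x +₂ y) (fromDigits (alignWith (mergeThese _+₂_) xs ys))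
        | half-digit x (fromDigits xs)
        | half-digit y (fromDigits ys) = bit-align k xs ys

bit-⊕ : ∀ k a b → bit k (a ⊕ b) ≡ bit k a ℙ.+ bit k b
bit-⊕ k a b = trans
  (bit-align k (proj₁ (toDigits 2 a)) (proj₁ (toDigits 2 b)))
  (cong₂ (λ x y → bit k x ℙ.+ bit k y) (proj₂ (toDigits 2 a)) (proj₂ (toDigits 2 b)))

half-⊕ : ∀ a b → ⌊ a ⊕ b /2⌋ ≡ ⌊ a /2⌋ ⊕ ⌊ b /2⌋
half-⊕ a b = bit-injective λ k →
  trans (bit-⊕ (suc k) a b) (sym (bit-⊕ k ⌊ a /2⌋ ⌊ b /2⌋))

-- The group of natural numbers under Nim-sum, with laws inherited from `Parity`.

⊕-assoc : ∀ a b c → (a ⊕ b) ⊕ c ≡ a ⊕ (b ⊕ c)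
⊕-assoc a b c = bit-injective λ k → begin
  bit k ((a ⊕ b) ⊕ c)                  ≡⟨ bit-⊕ k (a ⊕ b) c ⟩
  bit k (a ⊕ b) ℙ.+ bit k c            ≡⟨ cong (ℙ._+ bit k c) (bit-⊕ k a b) ⟩
  (bit k a ℙ.+ bit k b) ℙ.+ bit k c    ≡⟨ ℙ.+-assoc (bit k a) (bit k b) (bit k c) ⟩
  bit k a ℙ.+ (bit k b ℙ.+ bit k c)    ≡⟨ cong (bit k a ℙ.+_) (bit-⊕ k b c) ⟨
  bit k a ℙ.+ bit k (b ⊕ c)            ≡⟨ bit-⊕ k a (b ⊕ c) ⟨
  bit k (a ⊕ (b ⊕ c))                  ∎
  where open ≡-Reasoning

⊕-comm : ∀ a b → a ⊕ b ≡ b ⊕ a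
⊕-comm a b = bit-injective λ k → begin
  bit k (a ⊕ b)         ≡⟨ bit-⊕ k a b ⟩
  bit k a ℙ.+ bit k b   ≡⟨ ℙ.+-comm (bit k a) (bit k b) ⟩
  bit k b ℙ.+ bit k a   ≡⟨ bit-⊕ k b a ⟨
  bit k (b ⊕ a)         ∎
  where open ≡-Reasoning

⊕-identityˡ : ∀ a → 0 ⊕ a ≡ a
⊕-identityˡ a = bit-injective λ k →
  trans (bit-⊕ k 0 a) (cong (ℙ._+ bit k a) (bit-0 k))

⊕-identityʳ : ∀ a → a ⊕ 0 ≡ a
⊕-identityʳ a = trans (⊕-comm a 0) (⊕-identityˡ a)

⊕-self : ∀ a → a ⊕ a ≡ 0
⊕-self a = bit-injective λ k →
  trans (bit-⊕ k a a) (trans (ℙ.p+p≡0ℙ (bit k a)) (sym (bit-0 k)))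

-- Every number is its own inverse. With `id` as inversion, `inverseˡ-unique` says that `a ⊕ b ≡ 0`
-- forces `a ≡ b`.
⊕-0-isAbelianGroup : IsAbelianGroup _≡_ _⊕_ 0 id
⊕-0-isAbelianGroup = record
  { isGroup = record
    { isMonoid = record
      { isSemigroup = record
        { isMagma = record { isEquivalence = isEquivalence ; ∙-cong = cong₂ _⊕_ }
        ; assoc   = ⊕-assoc
        }
      ; identity = ⊕-identityˡ , ⊕-identityʳ
      }
    ; inverse = ⊕-self , ⊕-self
    ; ⁻¹-cong = id
    }
  ; comm = ⊕-comm
  }

⊕-0-abelianGroup : AbelianGroup 0ℓ 0ℓ
⊕-0-abelianGroup = record { isAbelianGroup = ⊕-0-isAbelianGroup }

open GroupProperties (AbelianGroup.group ⊕-0-abelianGroup)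
  using (inverseˡ-unique; \\-leftDividesˡ)
open CommutativeSemigroupProperties (AbelianGroup.commutativeSemigroup ⊕-0-abelianGroup)
  using (interchange; x∙yz≈y∙xz)

-- Nim-sum and order.

half-cancel-< : ∀ {a b} → ⌊ a /2⌋ < ⌊ b /2⌋ → a < b
half-cancel-< a<b = ≰⇒> λ b≤a → <⇒≱ a<b (⌊n/2⌋-mono b≤a)

even<odd : ∀ a b → parity a ≡ 0ℙ → parity b ≡ 1ℙ → ⌊ a /2⌋ ≡ ⌊ b /2⌋ → a < b
even<odd zero          (suc b)       _  _  _ = z<s
even<odd (suc (suc a)) (suc (suc b)) pa pb h = s<s (s<s (even<odd a b pa pb (suc-injective h)))

-- The witness is the position of the highest digit 1 of `s`: adding `s` keeps every digit of `a`
-- above it and turns the 1 there into 0. Halving `s` moves that position down to 0.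
leading-bit : ∀ s → s ≢ 0 → ∃[ k ] (bit k s ≡ 1ℙ × ∀ a → bit k a ≡ 1ℙ → a ⊕ s < a)
leading-bit = <-rec _ step
  where
  step : ∀ s →
    (∀ {t} → t < s → t ≢ 0 → ∃[ k ] (bit k t ≡ 1ℙ × ∀ a → bit k a ≡ 1ℙ → a ⊕ t < a)) →
    s ≢ 0 → ∃[ k ] (bit k s ≡ 1ℙ × ∀ a → bit k a ≡ 1ℙ → a ⊕ s < a)
  step zero          _  s≢0 = contradiction refl s≢0
  -- Adding 1 makes an odd `a` even and keeps its half.
  step (suc zero)    _  _   = 0 , refl , λ a odd → even<odd (a ⊕ 1) a
    (trans (bit-⊕ 0 a 1) (cong (ℙ._+ 1ℙ) odd)) odd
    (trans (half-⊕ a 1) (⊕-identityʳ ⌊ a /2⌋))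
  step s@(suc (suc n)) ih _ = case ih (⌊n/2⌋<n (suc n)) (λ ()) of λ where
    (k , s-bit , lowers) → suc k , s-bit , λ a a-bit →
      half-cancel-< (subst (_< ⌊ a /2⌋) (sym (half-⊕ a s)) (lowers ⌊ a /2⌋ a-bit))

-- Moves in ordinary Nim.

nimSum : ∀ {m} → Vec ℕ m → ℕ
nimSum []      = 0
nimSum (a ∷ v) = a ⊕ nimSum v

-- Adding the old entry cancels it from the sum, and adding `b` puts the new one in its place.
nimSum-update : ∀ {m} (v : Vec ℕ m) i b →
  nimSum (v [ i ]≔ b) ≡ (lookup v i ⊕ b) ⊕ nimSum v
nimSum-update (a ∷ v) zero b = begin
  b ⊕ nimSum v                ≡⟨ ⊕-identityˡ _ ⟨
  0 ⊕ (b ⊕ nimSum v)          ≡⟨ cong (_⊕ (b ⊕ nimSum v)) (⊕-self a) ⟨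
  (a ⊕ a) ⊕ (b ⊕ nimSum v)    ≡⟨ interchange a a b (nimSum v) ⟩
  (a ⊕ b) ⊕ (a ⊕ nimSum v)    ∎
  where open ≡-Reasoning
nimSum-update (a ∷ v) (suc i) b = trans
  (cong (a ⊕_) (nimSum-update v i b))
  (x∙yz≈y∙xz a (lookup v i ⊕ b) (nimSum v))

nimSum-move≢0 : ∀ {m} (v : Vec ℕ m) i {b} → b < lookup v i →
  nimSum v ≡ 0 → nimSum (v [ i ]≔ b) ≢ 0
nimSum-move≢0 v i {b} b< v≡0 moved≡0 = <⇒≢ b< (sym (inverseˡ-unique (lookup v i) b (begin
  lookup v i ⊕ b                ≡⟨ ⊕-identityʳ _ ⟨
  (lookup v i ⊕ b) ⊕ 0          ≡⟨ cong ((lookup v i ⊕ b) ⊕_) v≡0 ⟨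
  (lookup v i ⊕ b) ⊕ nimSum v   ≡⟨ nimSum-update v i b ⟨
  nimSum (v [ i ]≔ b)           ≡⟨ moved≡0 ⟩
  0                             ∎)))
  where open ≡-Reasoning

nimSum-bit : ∀ {m} k (v : Vec ℕ m) → bit k (nimSum v) ≡ 1ℙ → ∃[ i ] bit k (lookup v i) ≡ 1ℙ
nimSum-bit k [] eq = contradiction (trans (sym (bit-0 k)) eq) λ ()
nimSum-bit k (a ∷ v) eq with bit k a in a-bit
... | 1ℙ = zero , a-bit
... | 0ℙ = case nimSum-bit k v tail-bit of λ where (i , i-bit) → suc i , i-bit
  where
  tail-bit : bit k (nimSum v) ≡ 1ℙ
  tail-bit = trans (cong (ℙ._+ bit k (nimSum v)) (sym a-bit))
    (trans (sym (bit-⊕ k a (nimSum v))) eq)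

-- Bouton's move: some entry has a 1 at the leading position of the Nim-sum, and adding the Nim-sum
-- to that entry lowers it and makes the total 0.
nim-move : ∀ {m} (v : Vec ℕ m) → nimSum v ≢ 0 →
  ∃[ i ] ∃[ b ] (b < lookup v i × nimSum (v [ i ]≔ b) ≡ 0)
nim-move v v≢0 =
  let k , s-bit , lowers = leading-bit (nimSum v) v≢0
      i , i-bit          = nimSum-bit k v s-bit
  in i , lookup v i ⊕ nimSum v , lowers (lookup v i) i-bit , (begin
    nimSum (v [ i ]≔ (lookup v i ⊕ nimSum v))
      ≡⟨ nimSum-update v i _ ⟩
    (lookup v i ⊕ (lookup v i ⊕ nimSum v)) ⊕ nimSum v
      ≡⟨ cong (_⊕ nimSum v) (\\-leftDividesˡ (lookup v i) (nimSum v)) ⟩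
    nimSum v ⊕ nimSum v
      ≡⟨ ⊕-self (nimSum v) ⟩
    0 ∎)
  where open ≡-Reasoning

-- Three tokens and the shared square.

nimSum-triple : ∀ a b c → nimSum (a ∷ b ∷ c ∷ []) ≡ a ⊕ b ⊕ c
nimSum-triple a b c = begin
  a ⊕ (b ⊕ (c ⊕ 0))   ≡⟨ cong (λ x → a ⊕ (b ⊕ x)) (⊕-identityʳ c) ⟩
  a ⊕ (b ⊕ c)         ≡⟨ ⊕-assoc a b c ⟨
  a ⊕ b ⊕ c           ∎
  where open ≡-Reasoning

-- When two entries are 0, the Nim-sum equals the third.
all-zero : ∀ (v : Vec ℕ 3) → nimSum v ≡ 0 → ∀ {i j} → i ≢ j →
  lookup v i ≡ 0 → lookup v j ≡ 0 → ∀ k → lookup v k ≡ 0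
all-zero (a ∷ b ∷ c ∷ []) eq {i} {j} i≢j = cases i j i≢j
  where
  a⊕b≡c : a ⊕ b ≡ c
  a⊕b≡c = inverseˡ-unique (a ⊕ b) c (trans (sym (nimSum-triple a b c)) eq)

  first-two : a ≡ 0 → b ≡ 0 → ∀ k → lookup (a ∷ b ∷ c ∷ []) k ≡ 0
  first-two a≡0 b≡0 zero             = a≡0
  first-two a≡0 b≡0 (suc zero)       = b≡0
  first-two a≡0 b≡0 (suc (suc zero)) = trans (sym a⊕b≡c) (cong₂ _⊕_ a≡0 b≡0)

  outer : a ≡ 0 → c ≡ 0 → b ≡ 0
  outer a≡0 c≡0 = trans (sym (⊕-identityˡ b))
    (trans (cong (_⊕ b) (sym a≡0)) (trans a⊕b≡c c≡0))

  last-two : b ≡ 0 → c ≡ 0 → a ≡ 0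
  last-two b≡0 c≡0 = trans (inverseˡ-unique a b (trans a⊕b≡c c≡0)) b≡0

  cases : ∀ i j → i ≢ j → lookup (a ∷ b ∷ c ∷ []) i ≡ 0 → lookup (a ∷ b ∷ c ∷ []) j ≡ 0 →
    ∀ k → lookup (a ∷ b ∷ c ∷ []) k ≡ 0
  cases zero             zero             i≢j _ _ = contradiction refl i≢j
  cases zero             (suc zero)       _   p q = first-two p q
  cases zero             (suc (suc zero)) _   p q = first-two p (outer p q)
  cases (suc zero)       zero             _   p q = first-two q p
  cases (suc zero)       (suc zero)       i≢j _ _ = contradiction refl i≢j
  cases (suc zero)       (suc (suc zero)) _   p q = first-two (last-two p q) p
  cases (suc (suc zero)) zero             _   p q = first-two q (outer q p)
  cases (suc (suc zero)) (suc zero)       _   p q = first-two (last-two q p) q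
  cases (suc (suc zero)) (suc (suc zero)) i≢j _ _ = contradiction refl i≢j

nim-move-legal : ∀ (v : Vec ℕ 3) i b → Legal v → nimSum (v [ i ]≔ b) ≡ 0 → Legal (v [ i ]≔ b)
nim-move-legal v i b l eq j k j≡0 k≡0 = decidable-stable (j ≟ᶠ k) λ j≢k →
  -- `punchIn i` lists the two tokens that did not move. Both are on square 0 after the move, hence
  -- also before it, which contradicts `l`.
  let other≡0 : ∀ o → lookup v (punchIn i o) ≡ 0
      other≡0 o = trans (sym (lookup∘update′ (punchInᵢ≢i i o) v b))
        (all-zero (v [ i ]≔ b) eq j≢k j≡0 k≡0 (punchIn i o))
  in contradiction
    (punchIn-injective i zero (suc zero) (l _ _ (other≡0 zero) (other≡0 (suc zero)))) λ ()

-- Winning strategies.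

winning-move : ∀ (p : Position 3) → nimSum (squares p) ≢ 0 →
  ∃[ q ] (p ⟶ q × nimSum (squares q) ≡ 0)
winning-move p p≢0 =
  let i , b , b< , eq = nim-move (squares p) p≢0
  in mkPosition (squares p [ i ]≔ b) (nim-move-legal (squares p) i b (legal p) eq)
     , (i , b , b< , refl) , eq

⟶-nimSum≢0 : ∀ {m} (p q : Position m) → p ⟶ q →
  nimSum (squares p) ≡ 0 → nimSum (squares q) ≢ 0
⟶-nimSum≢0 p q (i , b , b< , eq) p≡0 q≡0 =
  nimSum-move≢0 (squares p) i b< p≡0 (trans (cong nimSum (sym eq)) q≡0)

sum-update-< : ∀ {m} (v : Vec ℕ m) i {b} → b < lookup v i → sum (v [ i ]≔ b) < sum v
sum-update-< (a ∷ v) zero    b< = +-monoˡ-< (sum v) b<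
sum-update-< (a ∷ v) (suc i) b< = +-monoʳ-< a (sum-update-< v i b<)

⟶-sum-< : ∀ {m} (p q : Position m) → p ⟶ q → sum (squares q) < sum (squares p)
⟶-sum-< p q (i , b , b< , eq) =
  subst (λ v → sum v < sum (squares p)) (sym eq) (sum-update-< (squares p) i b<)

-- Move to Nim-sum 0; every reply makes it nonzero again. The play ends because each move lowers the
-- total of the squares.
nimSum≢0⇒win : ∀ (p : Position 3) → nimSum (squares p) ≢ 0 → HasWinningStrategy p
nimSum≢0⇒win p = bounded (suc (sum (squares p))) p ≤-refl
  where
  bounded : ∀ n (p : Position 3) → sum (squares p) < n →
    nimSum (squares p) ≢ 0 → HasWinningStrategy p
  bounded (suc n) p p<n p≢0 =
    let q , p⟶q , q≡0 = winning-move p p≢0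
    in play q p⟶q λ r q⟶r → bounded n r
      (<-trans (⟶-sum-< q r q⟶r) (<-≤-trans (⟶-sum-< p q p⟶q) (s≤s⁻¹ p<n)))
      (⟶-nimSum≢0 q r q⟶r q≡0)

-- The opponent answers every move by restoring Nim-sum 0. A supposed strategy contains a smaller
-- one for the position so reached, and the recursion descends along it.
nimSum≡0⇒P : ∀ (p : Position 3) → nimSum (squares p) ≡ 0 → IsPPosition p
nimSum≡0⇒P p p≡0 (play q p⟶q replies) =
  let r , q⟶r , r≡0 = winning-move q (⟶-nimSum≢0 p q p⟶q p≡0)
  in nimSum≡0⇒P r r≡0 (replies r q⟶r)

proposition2 : (a₁ a₂ a₃ : ℕ) (l : Legal (a₁ ∷ a₂ ∷ a₃ ∷ [])) →
    IsPPosition (mkPosition (a₁ ∷ a₂ ∷ a₃ ∷ []) l) ⇔ (a₁ ⊕ a₂ ⊕ a₃ ≡ 0)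
proposition2 a₁ a₂ a₃ l = mk⇔
  -- `P` only refutes strategies, so the equation is obtained from its double negation.
  (λ P → trans (sym triple) (decidable-stable (nimSum (squares p) ≟ 0) λ p≢0 →
    P (nimSum≢0⇒win p p≢0)))
  (λ eq → nimSum≡0⇒P p (trans triple eq))
  where
  p : Position 3
  p = mkPosition (a₁ ∷ a₂ ∷ a₃ ∷ []) l

  triple : nimSum (squares p) ≡ a₁ ⊕ a₂ ⊕ a₃
  triple = nimSum-triple a₁ a₂ a₃
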